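{- Let $q$ be a power of a prime, let $b,k\in\mathbb{N}$ with $k\ge 3$, and let $F: \mathbb{F}_q^{bk}\rightarrow \mathbb{F}_q^b$ be the cellular automaton with local rule $f:\mathbb{F}_q^{b(k-1)+1} \rightarrow \mathbb{F}_q$ defined by $$f(x_1,\ldots, x_{b(k-1)+1}) = x_1 + a_2x_2 + \cdots + a_{b(k-1)}x_{b(k-1)} + x_{b(k-1)+1},$$ where $a_2,\ldots,a_{b(k-1)}\in\mathbb{F}_q$. Then the $k$-dimensional hypercube $\mathcal{H}_F$ of order $q^b$ associated to $F$ is a Latin hypercube if and only if, for all $i \in \{1,\ldots,k-2\}$, the $b\times b$ Toeplitz matrix $$M_{F,i} = \begin{pmatrix} a_{bi+1} & a_{bi+2} & \cdots & a_{b(i+1)} \\ a_{bi} & a_{bi+1} & \cdots & a_{b(i+1)-1} \\ \vdots & \vdots & \ddots & \vdots \\ a_{b(i-1)+2} & a_{b(i-1)+3} & \cdots & a_{bi+1} \end{pmatrix}$$ (whose $(r,c)$ entry is $a_{bi+1+c-r}$) is invertible.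
   Context: $\mathbb{N}$ denotes the positive integers, $\mathbb{F}_q$ is the finite field with $q$ elements, and $[N]=\{1,\ldots,N\}$. Latin hypercube: for a finite set $X$ of $N$ elements, a Latin hypercube of dimension $k$ and order $N$ over $X$ is a $k$-dimensional array with entries from $X$ such that, whenever any $k-1$ of the $k$ coordinates are fixed, letting the remaining coordinate vary yields a permutation of $X$ (each element of $X$ appears exactly once). Cellular automaton (CA): for $d\le n$ and $f:\mathbb{F}_q^d\to\mathbb{F}_q$, the CA of length $n$ and local rule $f$ is the map $F:\mathbb{F}_q^n\to\mathbb{F}_q^{n-d+1}$ with $F(x_1,\ldots,x_n) = (f(x_1,\ldots,x_d), f(x_2,\ldots,x_{d+1}),\ldots,f(x_{n-d+1},\ldots,x_n))$. Hypercube associated to a CA: the vectors in $\mathbb{F}_q^b$ are totally ordered, and $\Psi:[N]\to\mathbb{F}_q^b$, $N=q^b$, is the fixed monotone bijection. For a CA $F:\mathbb{F}_q^{bk}\to\mathbb{F}_q^b$ with local rule of $d=b(k-1)+1$ variables, $\mathcal{H}_F$ is the $k$-dimensional array of order $q^b$ with entries $\mathcal{H}_F(i_1,\ldots,i_k)=\Psi^{ -1}(F(\Psi(i_1)\,\|\,\cdots\,\|\,\Psi(i_k)))$ for $(i_1,\ldots,i_k)\in[N]^k$, where $\|$ is concatenation. -}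

module Defs where

open import Level using (Level) renaming (suc to lsuc)
open import Algebra.Apartness.Structures using (IsHeytingField)
open import Algebra.Bundles using (CommutativeRing)
open import Data.Fin.Base using (Fin; zero; suc; toℕ; fromℕ; fromℕ<; inject≤)
open import Data.Fin.Properties using (_≟_; toℕ<n)
open import Data.Nat.Base as ℕ using (ℕ; _∸_; _^_; _≤_; _<_; s≤s⁻¹)
open import Data.Nat.Primality using (Prime)
import Data.Nat.Properties as ℕ
open import Data.Product.Base using (_×_; ∃-syntax)
open import Data.Vec.Base using (Vec; lookup; tabulate; map; concat; _[_]≔_)
open import Function.Bundles using (_↔_; Inverse)
open import Function.Definitions using (Bijective)
open import Relation.Binary.PropositionalEquality using (_≡_; _≢_; cong)
open import Relation.Nullary.Decidable using (does)
open import Data.Bool.Base using (if_then_else_)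

IsPrimePower : ℕ → Set
IsPrimePower q = ∃[ p ] ∃[ m ] (Prime p × 1 ≤ m × q ≡ p ^ m)

-- A Heyting field whose apartness relation is _≢_ is a field in the
-- usual sense: it is nontrivial and every x ≢ 0# has an inverse.
record FiniteField (c : Level) (q : ℕ) : Set (lsuc c) where
  infixl 6 _+_
  infixl 7 _*_
  infix  8 -_
  field
    Carrier        : Set c
    _+_ _*_        : Carrier → Carrier → Carrier
    -_             : Carrier → Carrier
    0# 1#          : Carrier
    isHeytingField : IsHeytingField _≡_ _≢_ _+_ _*_ -_ 0# 1#
    enumeration    : Carrier ↔ Fin q

  open IsHeytingField isHeytingField public using (isCommutativeRing)

  commutativeRing : CommutativeRing c c
  commutativeRing = record { isCommutativeRing = isCommutativeRing }

-- The entries may be taken in any set X; for k ≥ 1 bijectivity forces X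
-- to have N elements.  Fixing all coordinates but the j-th is expressed by
-- overwriting the j-th coordinate of an arbitrary index vector.
IsLatinHypercube : ∀ {x} {X : Set x} {k N : ℕ} → (Vec (Fin N) k → X) → Set x
IsLatinHypercube {k = k} {N = N} H =
  ∀ (j : Fin k) (v : Vec (Fin N) k) → Bijective _≡_ _≡_ (λ t → H (v [ j ]≔ t))

module _ {c} {A : Set c} where

  window-bound : ∀ {n d m} → m ℕ.+ d ≡ ℕ.suc n →
                 (j : Fin m) (i : Fin d) → toℕ j ℕ.+ toℕ i < n
  window-bound {n} {d} {m} eq j i = s≤s⁻¹ (begin
    2 ℕ.+ (toℕ j ℕ.+ toℕ i)         ≡⟨ cong ℕ.suc (ℕ.+-suc (toℕ j) (toℕ i)) ⟨
    ℕ.suc (toℕ j) ℕ.+ ℕ.suc (toℕ i) ≤⟨ ℕ.+-mono-≤ (toℕ<n j) (toℕ<n i) ⟩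
    m ℕ.+ d                         ≡⟨ eq ⟩
    ℕ.suc n                         ∎)
    where open ℕ.≤-Reasoning

  -- The equation says that the output length is m = n - d + 1.
  cellularAutomaton : ∀ {n d m} → .(m ℕ.+ d ≡ ℕ.suc n) →
                      (Vec A d → A) → Vec A n → Vec A m
  cellularAutomaton eq f x =
    tabulate λ j → f (tabulate λ i → lookup x (fromℕ< (window-bound eq j i)))

  hypercube : ∀ {N b k} → Fin N ↔ Vec A b → (Vec A (k ℕ.* b) → Vec A b) →
              Vec (Fin N) k → Fin N
  hypercube Ψ F is = Inverse.from Ψ (F (concat (map (Inverse.to Ψ) is)))

module _ {c q} (𝔽 : FiniteField c q) where
  open FiniteField 𝔽
  open import Algebra.Properties.Monoid.Sum
    (CommutativeRing.+-monoid commutativeRing) using (sum)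

  -- x₁ + a₂x₂ + ⋯ + aₑxₑ + xₑ₊₁, for e ≥ 1.  The family a is indexed as
  -- in this formula and only its values at 2, …, e are used, whereas
  -- positions in x are counted from 0.
  linearRule : (e : ℕ) → (ℕ → Carrier) → Vec Carrier (ℕ.suc e) → Carrier
  linearRule e a x =
    lookup x zero
    + sum {e ∸ 1} (λ j → a (2 ℕ.+ toℕ j) * lookup x (suc (inject≤ j (ℕ.m∸n≤m e 1))))
    + lookup x (fromℕ e)

  length-eq : ∀ b k → 1 ≤ k → b ℕ.+ ℕ.suc ((k ∸ 1) ℕ.* b) ≡ ℕ.suc (k ℕ.* b)
  length-eq b (ℕ.suc k) _ = ℕ.+-suc b (k ℕ.* b)

  linearCA : (b k : ℕ) → .(1 ≤ k) → (ℕ → Carrier) →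
             Vec Carrier (k ℕ.* b) → Vec Carrier b
  linearCA b k 1≤k a =
    cellularAutomaton (length-eq b k 1≤k) (linearRule ((k ∸ 1) ℕ.* b) a)

  Matrix : ℕ → Set c
  Matrix n = Fin n → Fin n → Carrier

  identity : ∀ {n} → Matrix n
  identity r s = if does (r ≟ s) then 1# else 0#

  _⊗_ : ∀ {n} → Matrix n → Matrix n → Matrix n
  (M ⊗ M′) r s = sum λ t → M r t * M′ t s

  IsInvertible : ∀ {n} → Matrix n → Set c
  IsInvertible {n} M = ∃[ M′ ]
    ((∀ r s → (M ⊗ M′) r s ≡ identity r s) × (∀ r s → (M′ ⊗ M) r s ≡ identity r s))

  -- Counting rows and columns from 0 does not change their difference.
  -- The truncated subtraction is exact for i ≥ 1, as then r < b ≤ b i,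
  -- and for 1 ≤ i ≤ k - 2 the index lies between 2 and b(k-1).
  toeplitz : (b : ℕ) → (ℕ → Carrier) → ℕ → Matrix b
  toeplitz b a i r s = a (b ℕ.* i ℕ.+ 1 ℕ.+ toℕ s ∸ toℕ r)

{-# OPTIONS --safe #-}

-- Vary one block u of b coordinates and keep the other blocks fixed; since the
-- order of the hypercube is finite, only injectivity of u ↦ F matters.  If u is
-- the first block, the r-th output window starts at the r-th cell of u with
-- coefficient 1, so u is recovered from right to left; the last block is
-- recovered from left to right in the same way.  For a middle block i, every
-- output window contains the whole block in its interior, hence F = K + M u with
-- M the Toeplitz matrix M_{F,i}, and this is bijective exactly when M is invertible.
module Submission where

open import Defs
open import Level using (Level)
open import Algebra.Bundles using (CommutativeRing)
open import Data.Fin.Base using (Fin; zero; suc; toℕ; fromℕ; fromℕ<; inject≤; punchOut) renaming (_≤_ to _≤ᶠ_)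
open import Data.Fin.Properties using (_≟_; any?; toℕ<n; toℕ-fromℕ; toℕ-fromℕ<; toℕ-inject≤; injective⇒≤; punchOut-injective)
open import Data.Nat.Base using (ℕ; zero; suc; _+_; _*_; _∸_; _^_; _≤_; _<_; s≤s; z≤n; s≤s⁻¹)
import Data.Nat.Properties as ℕ
open import Data.Nat.Properties using (≤-trans)
open import Data.Nat.Tactic.RingSolver using (solve-∀)
open import Data.Product.Base using (_,_; proj₁; proj₂; ∃-syntax)
open import Data.Sum.Base using (inj₁; inj₂)
open import Data.Vec.Base using (Vec; []; _∷_; _++_; lookup; tabulate; map; concat; replicate; _[_]≔_)
open import Data.Vec.Properties using (lookup∘tabulate; tabulate∘lookup; tabulate-cong; map-[]≔)
open import Function.Base using (_∘_)
open import Function.Bundles using (_↔_; _⇔_; mk⇔; Inverse)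
open import Function.Definitions using (Injective; Surjective; Bijective)
open import Relation.Binary.Core using (Rel)
open import Relation.Binary.Definitions using (Monotonic₁)
open import Relation.Binary.Structures using (IsTotalOrder)
open import Relation.Binary.PropositionalEquality
  using (_≡_; _≢_; _≗_; refl; sym; trans; cong; cong₂; subst; module ≡-Reasoning)
open import Relation.Nullary.Decidable using (yes; no)
open import Relation.Nullary.Negation using (contradiction)

-- Self-maps of finite sets and extensionality of vectors.

-- Pigeonhole: if `y` were missed, punching it out of the codomain would inject `Fin (suc n)` into
-- `Fin n`.
injective⇒surjective : ∀ {n} {f : Fin n → Fin n} → Injective _≡_ _≡_ f → Surjective _≡_ _≡_ f
injective⇒surjective {suc n} {f} inj y with any? (λ x → f x ≟ y)
... | yes (x , fx≡y) = x , λ { refl → fx≡y }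
... | no  ∄x = contradiction (injective⇒≤ punchOut∘f-injective) ℕ.1+n≰n
  where
  y≢f : ∀ x → y ≢ f x
  y≢f x y≡fx = ∄x (x , sym y≡fx)

  punchOut∘f-injective : Injective _≡_ _≡_ (λ x → punchOut (y≢f x))
  punchOut∘f-injective = inj ∘ punchOut-injective (y≢f _) (y≢f _)

lookup-injective : ∀ {c} {A : Set c} {n} {xs ys : Vec A n} → lookup xs ≗ lookup ys → xs ≡ ys
lookup-injective {xs = xs} {ys} eq =
  trans (sym (tabulate∘lookup xs)) (trans (tabulate-cong eq) (tabulate∘lookup ys))

-- Vectors as sequences, and the blocks of a concatenation.

module _ {c} {A : Set c} (d : A) where

  -- Positions become plain natural numbers, so windows can be shifted by addition without bound
  -- proofs. Past the end all vectors of one length agree, with value `d`.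
  pad : ∀ {n} → Vec A n → ℕ → A
  pad []       _       = d
  pad (x ∷ xs) zero    = x
  pad (x ∷ xs) (suc p) = pad xs p

  pad-toℕ : ∀ {n} (xs : Vec A n) i → pad xs (toℕ i) ≡ lookup xs i
  pad-toℕ (x ∷ xs) zero    = refl
  pad-toℕ (x ∷ xs) (suc i) = pad-toℕ xs i

  pad-++ˡ : ∀ {m n} (xs : Vec A m) (ys : Vec A n) {p} → p < m → pad (xs ++ ys) p ≡ pad xs p
  pad-++ˡ (x ∷ xs) ys {zero}  _         = refl
  pad-++ˡ (x ∷ xs) ys {suc p} (s≤s p<m) = pad-++ˡ xs ys p<m

  pad-++ʳ : ∀ {m n} (xs : Vec A m) (ys : Vec A n) p → pad (xs ++ ys) (m + p) ≡ pad ys p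
  pad-++ʳ []       ys p = refl
  pad-++ʳ (x ∷ xs) ys p = pad-++ʳ xs ys p

  module _ {b : ℕ} where

    pad-concat-≔ : ∀ {k} (w : Vec (Vec A b) k) j u s →
                   pad (concat (w [ j ]≔ u)) (toℕ j * b + toℕ s) ≡ lookup u s
    pad-concat-≔ (x ∷ w) zero    u s = trans (pad-++ˡ u (concat w) (toℕ<n s)) (pad-toℕ u s)
    pad-concat-≔ (x ∷ w) (suc j) u s = begin
      pad (x ++ concat (w [ j ]≔ u)) (b + toℕ j * b + toℕ s)   ≡⟨ cong (pad (x ++ concat (w [ j ]≔ u))) (ℕ.+-assoc b (toℕ j * b) (toℕ s)) ⟩
      pad (x ++ concat (w [ j ]≔ u)) (b + (toℕ j * b + toℕ s)) ≡⟨ pad-++ʳ x _ _ ⟩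
      pad (concat (w [ j ]≔ u)) (toℕ j * b + toℕ s)            ≡⟨ pad-concat-≔ w j u s ⟩
      lookup u s                                               ∎
      where open ≡-Reasoning

    pad-concat-≔-below : ∀ {k} (w : Vec (Vec A b) k) j u u′ {p} → p < toℕ j * b →
                         pad (concat (w [ j ]≔ u)) p ≡ pad (concat (w [ j ]≔ u′)) p
    pad-concat-≔-below (x ∷ w) (suc j) u u′ {p} p<jb with p ℕ.<? b
    ... | yes p<b = trans (pad-++ˡ x _ p<b) (sym (pad-++ˡ x _ p<b))
    ... | no  p≮b with ℕ.m≤n⇒∃[o]m+o≡n (ℕ.≮⇒≥ p≮b)
    ...   | p′ , refl = trans (pad-++ʳ x _ p′) (trans
              (pad-concat-≔-below w j u u′ (ℕ.+-cancelˡ-< b p′ _ p<jb))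
              (sym (pad-++ʳ x _ p′)))

    -- No upper bound on `p` is imposed: beyond the end both sides are `d`. Agreement on all later
    -- positions is what the recovery of the first block asks for.
    pad-concat-≔-above : ∀ {k} (w : Vec (Vec A b) k) j u u′ {p} → suc (toℕ j) * b ≤ p →
                         pad (concat (w [ j ]≔ u)) p ≡ pad (concat (w [ j ]≔ u′)) p
    pad-concat-≔-above (x ∷ w) j u u′ jb≤p with ℕ.m≤n⇒∃[o]m+o≡n (ℕ.m+n≤o⇒m≤o b jb≤p)
    pad-concat-≔-above (x ∷ w) zero    u u′ jb≤p | p′ , refl =
      trans (pad-++ʳ u _ p′) (sym (pad-++ʳ u′ _ p′))
    pad-concat-≔-above (x ∷ w) (suc j) u u′ jb≤p | p′ , refl = trans (pad-++ʳ x _ p′) (trans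
      (pad-concat-≔-above w j u u′ (ℕ.+-cancelˡ-≤ b _ p′ jb≤p))
      (sym (pad-++ʳ x _ p′)))

module _ {c q} (𝔽 : FiniteField c q) where

  open FiniteField 𝔽 using (Carrier; commutativeRing) renaming (_+_ to _⊞_; _*_ to _⊠_)
  open CommutativeRing commutativeRing
    using (+-assoc; +-identityˡ; +-identityʳ; *-assoc; *-comm; *-identityˡ; zeroˡ; 0#; 1#;
           +-group; +-commutativeMonoid; semiring)
  open import Algebra.Properties.Group +-group using (∙-cancelˡ; ∙-cancelʳ)
  open import Algebra.Properties.CommutativeMonoid.Sum +-commutativeMonoid
    using (sum; sum-cong-≗; ∑-comm; sum-replicate-zero)
  open import Algebra.Properties.Semiring.Sum semiring using (*-distribˡ-sum; *-distribʳ-sum)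

  open import Algebra.Solver.CommutativeMonoid +-commutativeMonoid using (solve; _⊕_; _⊜_)

  -- Matrices acting on vectors.

  infixr 7 _·_
  _·_ : ∀ {n} → Matrix 𝔽 n → (Fin n → Carrier) → Fin n → Carrier
  (M · v) r = sum λ s → M r s ⊠ v s

  identity-· : ∀ {n} (v : Fin n → Carrier) → identity 𝔽 · v ≗ v
  identity-· {suc n} v zero = begin
    1# ⊠ v zero ⊞ sum (λ s → 0# ⊠ v (suc s)) ≡⟨ cong₂ _⊞_ (*-identityˡ _) (sum-cong-≗ λ s → zeroˡ (v (suc s))) ⟩
    v zero ⊞ sum {n} (λ _ → 0#)              ≡⟨ cong (v zero ⊞_) (sum-replicate-zero n) ⟩
    v zero ⊞ 0#                              ≡⟨ +-identityʳ _ ⟩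
    v zero                                   ∎
    where open ≡-Reasoning
  identity-· v (suc r) = begin
    0# ⊠ v zero ⊞ (identity 𝔽 · v ∘ suc) r ≡⟨ cong₂ _⊞_ (zeroˡ _) (identity-· (v ∘ suc) r) ⟩
    0# ⊞ v (suc r)                         ≡⟨ +-identityˡ _ ⟩
    v (suc r)                              ∎
    where open ≡-Reasoning

  identity-sym : ∀ {n} (r s : Fin n) → identity 𝔽 r s ≡ identity 𝔽 s r
  identity-sym zero    zero    = refl
  identity-sym zero    (suc s) = refl
  identity-sym (suc r) zero    = refl
  identity-sym (suc r) (suc s) = identity-sym r s

  -- Since the identity is symmetric and multiplication commutes, the sum is the identity matrix
  -- applied to row `r`.
  ·-identity : ∀ {n} (M : Matrix 𝔽 n) r s → (M · λ t → identity 𝔽 t s) r ≡ M r s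
  ·-identity M r s = begin
    sum (λ t → M r t ⊠ identity 𝔽 t s) ≡⟨ sum-cong-≗ (λ t → trans (*-comm _ _) (cong (_⊠ M r t) (identity-sym t s))) ⟩
    (identity 𝔽 · M r) s               ≡⟨ identity-· (M r) s ⟩
    M r s                              ∎
    where open ≡-Reasoning

  ⊗-· : ∀ {n} (M M′ : Matrix 𝔽 n) v → _⊗_ 𝔽 M M′ · v ≗ M · M′ · v
  ⊗-· M M′ v r = begin
    sum (λ s → sum (λ t → M r t ⊠ M′ t s) ⊠ v s)   ≡⟨ sum-cong-≗ (λ s → *-distribʳ-sum (v s) (λ t → M r t ⊠ M′ t s)) ⟩
    sum (λ s → sum (λ t → M r t ⊠ M′ t s ⊠ v s))   ≡⟨ ∑-comm (λ s t → M r t ⊠ M′ t s ⊠ v s) ⟩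
    sum (λ t → sum (λ s → M r t ⊠ M′ t s ⊠ v s))   ≡⟨ sum-cong-≗ (λ t → sum-cong-≗ λ s → *-assoc (M r t) (M′ t s) (v s)) ⟩
    sum (λ t → sum (λ s → M r t ⊠ (M′ t s ⊠ v s))) ≡⟨ sum-cong-≗ (λ t → *-distribˡ-sum (M r t) (λ s → M′ t s ⊠ v s)) ⟨
    sum (λ t → M r t ⊠ sum (λ s → M′ t s ⊠ v s))   ∎
    where open ≡-Reasoning

  ·-cong : ∀ {n} {M M′ : Matrix 𝔽 n} {v v′} → (∀ r s → M r s ≡ M′ r s) → v ≗ v′ → M · v ≗ M′ · v′
  ·-cong M≡M′ v≗v′ r = sum-cong-≗ λ s → cong₂ _⊠_ (M≡M′ r s) (v≗v′ s)

  -- The columns of the inverse are preimages under M; that it is also a left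
  -- inverse follows by cancelling M from M (M′ M) = M.
  bijective⇒invertible : ∀ {n} (M : Matrix 𝔽 n) →
    (∀ {v v′} → M · v ≗ M · v′ → v ≗ v′) → (∀ v → ∃[ v′ ] M · v′ ≗ v) → IsInvertible 𝔽 M
  bijective⇒invertible M inj sur = M′ , MM′≡I , M′M≡I
    where
    open ≡-Reasoning

    M′ : Matrix 𝔽 _
    M′ t s = proj₁ (sur λ r → identity 𝔽 r s) t

    MM′≡I : ∀ r s → _⊗_ 𝔽 M M′ r s ≡ identity 𝔽 r s
    MM′≡I r s = proj₂ (sur λ r → identity 𝔽 r s) r

    M′M≡I : ∀ r s → _⊗_ 𝔽 M′ M r s ≡ identity 𝔽 r s
    M′M≡I r s = inj {v = λ t → _⊗_ 𝔽 M′ M t s} {v′ = λ t → identity 𝔽 t s} (λ r → begin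
      (M · M′ · λ t → M t s) r         ≡⟨ ⊗-· M M′ (λ t → M t s) r ⟨
      (_⊗_ 𝔽 M M′ · λ t → M t s) r     ≡⟨ ·-cong MM′≡I (λ _ → refl) r ⟩
      (identity 𝔽 · λ t → M t s) r     ≡⟨ identity-· (λ t → M t s) r ⟩
      M r s                            ≡⟨ ·-identity M r s ⟨
      (M · λ t → identity 𝔽 t s) r     ∎) r

  invertible⇒injective : ∀ {n} {M : Matrix 𝔽 n} → IsInvertible 𝔽 M →
    ∀ {v v′} → M · v ≗ M · v′ → v ≗ v′
  invertible⇒injective {M = M} (M′ , _ , M′M≡I) {v} {v′} Mv≗Mv′ r = begin
    v r                    ≡⟨ M′·M· v ⟨
    (M′ · M · v) r         ≡⟨ ·-cong {M = M′} (λ _ _ → refl) Mv≗Mv′ r ⟩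
    (M′ · M · v′) r        ≡⟨ M′·M· v′ ⟩
    v′ r                   ∎
    where
    open ≡-Reasoning

    M′·M· : ∀ v → (M′ · M · v) r ≡ v r
    M′·M· v = begin
      (M′ · M · v) r        ≡⟨ ⊗-· M′ M v r ⟨
      (_⊗_ 𝔽 M′ M · v) r    ≡⟨ ·-cong M′M≡I (λ _ → refl) r ⟩
      (identity 𝔽 · v) r    ≡⟨ identity-· v r ⟩
      v r                   ∎

  -- The local rule on sequences and recovery of the outer blocks.

  -- The local rule on sequences: windows at all positions of a padded vector then
  -- become shifts of a single function on ℕ.
  rule : (e : ℕ) → (ℕ → Carrier) → (ℕ → Carrier) → Carrier
  rule e a g = g 0 ⊞ sum {e ∸ 1} (λ j → a (2 + toℕ j) ⊠ g (suc (toℕ j))) ⊞ g e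

  lookup-linearCA : ∀ b k .(1≤k : 1 ≤ suc k) a (x : Vec Carrier (suc k * b)) r →
    lookup (linearCA 𝔽 b (suc k) 1≤k a x) r ≡ rule (k * b) a (λ p → pad 0# x (toℕ r + p))
  lookup-linearCA b k 1≤k a x r = trans (lookup∘tabulate (linearRule 𝔽 (k * b) a ∘ windowAt) r) (cong₂ _⊞_
    (cong₂ _⊞_ (window zero refl)
      (sum-cong-≗ λ j → cong (a (2 + toℕ j) ⊠_)
        (window (suc (inject≤ j (ℕ.m∸n≤m (k * b) 1))) (cong suc (toℕ-inject≤ j _)))))
    (window (fromℕ (k * b)) (toℕ-fromℕ (k * b))))
    where
    open ≡-Reasoning

    cell : Fin b → Fin (suc (k * b)) → Carrier
    cell r i = lookup x (fromℕ< (window-bound {A = Carrier} (length-eq 𝔽 b (suc k) 1≤k) r i))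

    windowAt : Fin b → Vec Carrier (suc (k * b))
    windowAt r = tabulate (cell r)

    window : ∀ i {p} → toℕ i ≡ p →
      lookup (windowAt r) i ≡ pad 0# x (toℕ r + p)
    window i refl = begin
      lookup (windowAt r) i               ≡⟨ lookup∘tabulate (cell r) i ⟩
      lookup x (fromℕ< r+i<n)             ≡⟨ pad-toℕ 0# x _ ⟨
      pad 0# x (toℕ (fromℕ< r+i<n))       ≡⟨ cong (pad 0# x) (toℕ-fromℕ< r+i<n) ⟩
      pad 0# x (toℕ r + toℕ i)            ∎
      where
      -- The irrelevant `1≤k` cannot be used in this relevant proof, so an explicit one replaces it;
      -- `fromℕ<` ignores its proof, hence the cell is the same.
      r+i<n : toℕ r + toℕ i < suc k * b
      r+i<n = window-bound {A = Carrier} (length-eq 𝔽 b (suc k) (s≤s z≤n)) r i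

  -- The last coefficient is 1, so it cancels without division. With `1 ≤ e` the positions 0 and `e`
  -- are distinct; for `e = 0` the rule would be twice `g 0`, which vanishes in characteristic 2.
  rule-cancel-last : ∀ {e} a (g h : ℕ → Carrier) → 1 ≤ e → (∀ {p} → p < e → g p ≡ h p) →
                   rule e a g ≡ rule e a h → g e ≡ h e
  rule-cancel-last {suc e} a g h _ g≡h eq = ∙-cancelˡ _ _ _ (trans eq (cong (_⊞ h (suc e)) (cong₂ _⊞_
    (sym (g≡h (s≤s z≤n)))
    (sum-cong-≗ {n = e} λ j → cong (a (2 + toℕ j) ⊠_) (sym (g≡h (s≤s (toℕ<n j))))))))

  rule-cancel-first : ∀ {e} a (g h : ℕ → Carrier) → 1 ≤ e → (∀ p → g (suc p) ≡ h (suc p)) →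
                    rule e a g ≡ rule e a h → g 0 ≡ h 0
  rule-cancel-first {suc e} a g h _ g≡h eq =
    ∙-cancelʳ _ _ _ (∙-cancelʳ _ _ _ (trans eq (cong₂ _⊞_
      (cong (h 0 ⊞_) (sum-cong-≗ {n = e} λ j → cong (a (2 + toℕ j) ⊠_) (sym (g≡h (toℕ j)))))
      (sym (g≡h e)))))

  -- Cells are recovered in decreasing order: in the window at `p` every cell after the first is
  -- known already, and the first has coefficient 1.
  rule-determines-first-block : ∀ {b e} a (g h : ℕ → Carrier) → 1 ≤ e →
    (∀ {r} → r < b → rule e a (λ p → g (r + p)) ≡ rule e a (λ p → h (r + p))) →
    (∀ {p} → b ≤ p → g p ≡ h p) → g ≗ h
  rule-determines-first-block {b} a g h 1≤e eq g≡h p = go b (ℕ.m≤n+m b p)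
    where
    -- `n` bounds the distance from `p` up to `b`; every later cell satisfies the bound with `n`
    -- lowered by one.
    go : ∀ n {p} → b ≤ p + n → g p ≡ h p
    go zero        b≤p+0 = g≡h (subst (b ≤_) (ℕ.+-identityʳ _) b≤p+0)
    go (suc n) {p} b≤p+n with p ℕ.<? b
    ... | no  p≮b = g≡h (ℕ.≮⇒≥ p≮b)
    ... | yes p<b = subst (λ p → g p ≡ h p) (ℕ.+-identityʳ p)
      (rule-cancel-first a (λ p′ → g (p + p′)) (λ p′ → h (p + p′)) 1≤e
        (λ p′ → go n (ℕ.≤-trans b≤p+n
          (ℕ.≤-trans (ℕ.≤-reflexive (ℕ.+-suc p n))
          (ℕ.≤-trans (s≤s (ℕ.+-monoˡ-≤ n (ℕ.m≤m+n p p′)))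
          (ℕ.≤-reflexive (cong (_+ n) (sym (ℕ.+-suc p p′))))))))
        (eq p<b))

  -- The window at `r` ends at `r + e`, so increasing `r` reveals one new cell at a time, again with
  -- coefficient 1.
  rule-determines-last-block : ∀ {b e} a (g h : ℕ → Carrier) → 1 ≤ e →
    (∀ {r} → r < b → rule e a (λ p → g (r + p)) ≡ rule e a (λ p → h (r + p))) →
    (∀ {p} → p < e → g p ≡ h p) → ∀ {r} → r < b → g (r + e) ≡ h (r + e)
  rule-determines-last-block {b} {e} a g h 1≤e eq g≡h {r} r<b = go b r<b ℕ.≤-refl
    where
    go : ∀ n {r} → r < n → n ≤ b → g (r + e) ≡ h (r + e)
    -- Joins the cells before `e`, equal by assumption, to the `n` cells from `e` on that are
    -- recovered already.
    below : ∀ n → n ≤ b → ∀ {p} → p < n + e → g p ≡ h p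

    below n n≤b {p} p<n+e with p ℕ.<? e
    ... | yes p<e = g≡h p<e
    ... | no  p≮e with ℕ.m≤n⇒∃[o]m+o≡n (ℕ.≮⇒≥ p≮e)
    ...   | r , refl = subst (λ p → g p ≡ h p) (ℕ.+-comm r e)
              (go n (ℕ.+-cancelʳ-< e r n (subst (_< n + e) (ℕ.+-comm e r) p<n+e)) n≤b)

    go (suc n) {r} (s≤s r≤n) n<b = rule-cancel-last a (λ p → g (r + p)) (λ p → h (r + p)) 1≤e
      (λ {p} p<e → below n (ℕ.<⇒≤ n<b) (ℕ.+-mono-≤-< r≤n p<e))
      (eq (ℕ.<-≤-trans (s≤s r≤n) n<b))

  -- Splitting the local rule around an interior block.

  sum-+ : ∀ m n (f : ℕ → Carrier) →
    sum {m + n} (f ∘ toℕ) ≡ sum {m} (f ∘ toℕ) ⊞ sum {n} (f ∘ (m +_) ∘ toℕ)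
  sum-+ zero    n f = sym (+-identityˡ _)
  sum-+ (suc m) n f = trans (cong (f 0 ⊞_) (sum-+ m n (f ∘ suc))) (sym (+-assoc _ _ _))

  -- The part of the rule not involving the block g (1 + o), …, g (o + b).
  ruleOutside : (e o b n : ℕ) → (ℕ → Carrier) → (ℕ → Carrier) → Carrier
  ruleOutside e o b n a g = g 0
    ⊞ (sum {o} (λ j → a (2 + toℕ j) ⊠ g (suc (toℕ j)))
      ⊞ sum {n} (λ j → a (2 + (o + (b + toℕ j))) ⊠ g (suc (o + (b + toℕ j)))))
    ⊞ g e

  -- The equation for `e` counts the cells after position 0: `o` before the block, `b` in it, `n`
  -- after it, and the final cell `e`.
  ruleOutside-cong : ∀ {e} o b n a {g h} → e ≡ suc (o + (b + n)) →
    (∀ {p} → p ≤ o → g p ≡ h p) → (∀ {p} → o + b < p → g p ≡ h p) →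
    ruleOutside e o b n a g ≡ ruleOutside e o b n a h
  ruleOutside-cong o b n a {g} {h} refl below above = cong₂ _⊞_
    (cong₂ _⊞_ (below z≤n) (cong₂ _⊞_
      (sum-cong-≗ {n = o} λ j → cong (a (2 + toℕ j) ⊠_) (below (toℕ<n j)))
      (sum-cong-≗ {n = n} λ j → cong (a (2 + (o + (b + toℕ j))) ⊠_) (above (s≤s (past (toℕ j)))))))
    (above (s≤s (past n)))
    where
    past : ∀ m → o + b ≤ o + (b + m)
    past m = ℕ.+-monoʳ-≤ o (ℕ.m≤m+n b m)

  rule-split : ∀ {e} o b n a g → e ≡ suc (o + (b + n)) →
    rule e a g ≡ ruleOutside e o b n a g ⊞ sum {b} (λ s → a (2 + (o + toℕ s)) ⊠ g (suc (o + toℕ s)))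
  rule-split o b n a g refl = begin
    g 0 ⊞ sum {o + (b + n)} (f ∘ toℕ) ⊞ gₑ  ≡⟨ cong (λ x → g 0 ⊞ x ⊞ gₑ) (trans
      (sum-+ o (b + n) f) (cong (A ⊞_) (sum-+ b n (f ∘ (o +_))))) ⟩
    g 0 ⊞ (A ⊞ (B ⊞ C)) ⊞ gₑ
      ≡⟨ solve 5 (λ x A B C y → (x ⊕ (A ⊕ (B ⊕ C))) ⊕ y ⊜ ((x ⊕ (A ⊕ C)) ⊕ y) ⊕ B) refl (g 0) A B C gₑ ⟩
    g 0 ⊞ (A ⊞ C) ⊞ gₑ ⊞ B                 ∎
    where
    open ≡-Reasoning

    f : ℕ → Carrier
    f j = a (2 + j) ⊠ g (suc j)

    gₑ = g (suc (o + (b + n)))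
    A = sum {o} (f ∘ toℕ)
    B = sum {b} (f ∘ (o +_) ∘ toℕ)
    C = sum {n} (f ∘ (o +_) ∘ (b +_) ∘ toℕ)

  -- The output as a function of a single block.

  module _ (b k : ℕ) (1≤b : 1 ≤ b) .(1≤k : 1 ≤ suc k) (a : ℕ → Carrier) where

    -- The dimension is `suc k`, so the rule has `e = k * b`, which is also where the last block
    -- starts.
    blockMap : Fin (suc k) → Vec (Vec Carrier b) (suc k) → Vec Carrier b → Vec Carrier b
    blockMap j w u = linearCA 𝔽 b (suc k) 1≤k a (concat (w [ j ]≔ u))

    private
      padded : Fin (suc k) → Vec (Vec Carrier b) (suc k) → Vec Carrier b → ℕ → Carrier
      padded j w u = pad 0# (concat (w [ j ]≔ u))

    blockMap-rule : ∀ {j w u u′} → blockMap j w u ≡ blockMap j w u′ → ∀ {r} → r < b →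
      rule (k * b) a (λ p → padded j w u (r + p)) ≡ rule (k * b) a (λ p → padded j w u′ (r + p))
    blockMap-rule {j} {w} {u} {u′} eq {r} r<b =
      subst (λ r → rule (k * b) a (λ p → padded j w u (r + p)) ≡ rule (k * b) a (λ p → padded j w u′ (r + p)))
        (toℕ-fromℕ< r<b)
        (trans (sym (lookup-linearCA b k 1≤k a (concat (w [ j ]≔ u)) i))
          (trans (cong (λ x → lookup x i) eq) (lookup-linearCA b k 1≤k a (concat (w [ j ]≔ u′)) i)))
      where i = fromℕ< r<b

    blockMap-first-injective : 1 ≤ k → ∀ w → Injective _≡_ _≡_ (blockMap zero w)
    blockMap-first-injective 1≤k w {u} {u′} eq = lookup-injective λ s → begin
      lookup u s                    ≡⟨ pad-concat-≔ 0# w zero u s ⟨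
      padded zero w u (toℕ s)       ≡⟨ rule-determines-first-block a (padded zero w u) (padded zero w u′) (ℕ.*-mono-≤ 1≤k 1≤b)
        (blockMap-rule {zero} {w} {u} {u′} eq)
        (λ b≤p → pad-concat-≔-above 0# w zero u u′ (subst (_≤ _) (sym (ℕ.+-identityʳ b)) b≤p)) (toℕ s) ⟩
      padded zero w u′ (toℕ s)      ≡⟨ pad-concat-≔ 0# w zero u′ s ⟩
      lookup u′ s                   ∎
      where open ≡-Reasoning

    blockMap-last-injective : 1 ≤ k → ∀ {j} → toℕ j ≡ k → ∀ w → Injective _≡_ _≡_ (blockMap j w)
    blockMap-last-injective 1≤k {j} j≡k w {u} {u′} eq = lookup-injective λ s → begin
      lookup u s                         ≡⟨ pad-concat-≔ 0# w j u s ⟨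
      padded j w u (toℕ j * b + toℕ s)   ≡⟨ cong (padded j w u) (position s) ⟩
      padded j w u (toℕ s + k * b)       ≡⟨ rule-determines-last-block a (padded j w u) (padded j w u′) (ℕ.*-mono-≤ 1≤k 1≤b)
        (blockMap-rule {j} {w} {u} {u′} eq)
        (λ p<kb → pad-concat-≔-below 0# w j u u′ (subst (λ i → _ < i * b) (sym j≡k) p<kb)) (toℕ<n s) ⟩
      padded j w u′ (toℕ s + k * b)      ≡⟨ cong (padded j w u′) (position s) ⟨
      padded j w u′ (toℕ j * b + toℕ s)  ≡⟨ pad-concat-≔ 0# w j u′ s ⟩
      lookup u′ s                        ∎
      where
      open ≡-Reasoning

      position : ∀ s → toℕ j * b + toℕ {b} s ≡ toℕ s + k * b
      position s = trans (ℕ.+-comm (toℕ j * b) (toℕ s)) (cong (λ i → toℕ s + i * b) j≡k)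

    blockMap-affine : ∀ j → 1 ≤ toℕ j → toℕ j < k → ∀ w → ∃[ K ] ∀ u r →
      lookup (blockMap j w u) r ≡ K r ⊞ (toeplitz 𝔽 b a (toℕ j) · lookup u) r
    blockMap-affine j 1≤i i<k w = (λ r → proj₁ (row r)) , λ u r → proj₂ (row r) u
      where
      i = toℕ j

      row : ∀ r → ∃[ K ] ∀ u → lookup (blockMap j w u) r ≡ K ⊞ (toeplitz 𝔽 b a i · lookup u) r
      -- As `r < b ≤ i * b`, the window starts strictly before block `i`; `o` is the number of cells
      -- between its first cell and the block.
      row r with ℕ.m≤n⇒∃[o]m+o≡n (ℕ.<-≤-trans (toℕ<n r) (ℕ.≤-trans (ℕ.≤-reflexive (sym (ℕ.*-identityˡ b))) (ℕ.*-monoˡ-≤ b 1≤i)))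
      -- Block `i` also ends before the last cell of the window, because `i < k`; `n` counts the
      -- cells in between.
      ... | o , r+o≡ib with ℕ.m≤n⇒∃[o]m+o≡n {suc (o + b)} (begin
        suc o + b             ≤⟨ ℕ.+-monoˡ-≤ b (s≤s (ℕ.m≤n+m o (toℕ r))) ⟩
        suc (toℕ r) + o + b   ≡⟨ cong (_+ b) r+o≡ib ⟩
        i * b + b             ≡⟨ ℕ.+-comm (i * b) b ⟩
        suc i * b             ≤⟨ ℕ.*-monoˡ-≤ b i<k ⟩
        k * b                 ∎)
        where open ℕ.≤-Reasoning
      -- The zero block is a placeholder: the outside part does not see block `j`, so this constant
      -- is independent of `u`.
      ...   | n , o+b+n≡kb = ruleOutside (k * b) o b n a (g (replicate b 0#)) , λ u → begin
        lookup (blockMap j w u) r   ≡⟨ lookup-linearCA b k 1≤k a (concat (w [ j ]≔ u)) r ⟩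
        rule (k * b) a (g u)        ≡⟨ rule-split o b n a (g u) kb≡ ⟩
        ruleOutside (k * b) o b n a (g u) ⊞ sum {b} (λ s → a (2 + (o + toℕ s)) ⊠ g u (suc (o + toℕ s)))
          ≡⟨ cong₂ _⊞_
               (ruleOutside-cong o b n a kb≡
                 (λ p≤o → pad-concat-≔-below 0# w j u (replicate b 0#) (below p≤o))
                 (λ o+b<p → pad-concat-≔-above 0# w j u (replicate b 0#) (above o+b<p)))
               (sum-cong-≗ λ s → cong₂ _⊠_ (cong a (entry (toℕ s))) (trans
                 (cong (padded j w u) (position (toℕ s)))
                 (pad-concat-≔ 0# w j u s))) ⟩
        ruleOutside (k * b) o b n a (g (replicate b 0#)) ⊞ (toeplitz 𝔽 b a i · lookup u) r ∎
        where
        open ≡-Reasoning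

        g : Vec Carrier b → ℕ → Carrier
        g u p = padded j w u (toℕ r + p)

        kb≡ : k * b ≡ suc (o + (b + n))
        kb≡ = trans (sym o+b+n≡kb) (cong suc (ℕ.+-assoc o b n))

        below : ∀ {p} → p ≤ o → toℕ r + p < i * b
        below {p} p≤o = subst (toℕ r + p <_) r+o≡ib (s≤s (ℕ.+-monoʳ-≤ (toℕ r) p≤o))

        above : ∀ {p} → o + b < p → suc i * b ≤ toℕ r + p
        above {p} o+b<p = subst (_≤ toℕ r + p) (trans (shift (toℕ r) o b) (cong (b +_) r+o≡ib)) (ℕ.+-monoʳ-≤ (toℕ r) o+b<p)
          where
          shift : ∀ r o b → r + suc (o + b) ≡ b + (suc r + o)
          shift = solve-∀

        position : ∀ s → toℕ r + suc (o + s) ≡ i * b + s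
        position s = trans (shift (toℕ r) o s) (cong (_+ s) r+o≡ib)
          where
          shift : ∀ r o s → r + suc (o + s) ≡ suc r + o + s
          shift = solve-∀

        -- The coefficient met by cell `s` of the block is the Toeplitz entry; adding `r` to both
        -- sides handles the truncated subtraction.
        entry : ∀ s → 2 + (o + s) ≡ b * i + 1 + s ∸ toℕ r
        entry s = trans (sym (ℕ.m+n∸m≡n (toℕ r) _)) (cong (_∸ toℕ r) (trans
          (shift (toℕ r) o s)
          (cong (λ m → m + 1 + s) (trans r+o≡ib (ℕ.*-comm i b)))))
          where
          shift : ∀ r o s → r + (2 + (o + s)) ≡ suc r + o + 1 + s
          shift = solve-∀

    blockMap-injective : ∀ j → 1 ≤ toℕ j → toℕ j < k → IsInvertible 𝔽 (toeplitz 𝔽 b a (toℕ j)) →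
      ∀ w → Injective _≡_ _≡_ (blockMap j w)
    blockMap-injective j 1≤j j<k inv w {u} {u′} eq with blockMap-affine j 1≤j j<k w
    ... | K , affine = lookup-injective (invertible⇒injective inv λ r → ∙-cancelˡ (K r) _ _
      (trans (sym (affine u r)) (trans (cong (λ x → lookup x r) eq) (affine u′ r))))

    blockMap-invertible : ∀ j → 1 ≤ toℕ j → toℕ j < k → ∀ w →
      Bijective _≡_ _≡_ (blockMap j w) → IsInvertible 𝔽 (toeplitz 𝔽 b a (toℕ j))
    blockMap-invertible j 1≤j j<k w (inj , sur) with blockMap-affine j 1≤j j<k w
    ... | K , affine = bijective⇒invertible T
      (λ {v} {v′} Tv≗Tv′ r → begin
        v r                        ≡⟨ lookup∘tabulate v r ⟨
        lookup (tabulate v) r      ≡⟨ cong (λ u → lookup u r) (inj (lookup-injective λ r → begin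
          lookup (blockMap j w (tabulate v)) r  ≡⟨ affine-tabulate v r ⟩
          K r ⊞ (T · v) r                       ≡⟨ cong (K r ⊞_) (Tv≗Tv′ r) ⟩
          K r ⊞ (T · v′) r                      ≡⟨ affine-tabulate v′ r ⟨
          lookup (blockMap j w (tabulate v′)) r ∎)) ⟩
        lookup (tabulate v′) r     ≡⟨ lookup∘tabulate v′ r ⟩
        v′ r                       ∎)
      -- A preimage of `v` under `T` is a preimage of the translate `K + v` under the block map.
      (λ v → let u , φu≡ = sur (tabulate λ r → K r ⊞ v r) in
        lookup u , λ r → ∙-cancelˡ (K r) _ _ (begin
          K r ⊞ (T · lookup u) r                ≡⟨ affine u r ⟨
          lookup (blockMap j w u) r             ≡⟨ cong (λ x → lookup x r) (φu≡ refl) ⟩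
          lookup (tabulate λ r → K r ⊞ v r) r   ≡⟨ lookup∘tabulate _ r ⟩
          K r ⊞ v r                             ∎))
      where
      open ≡-Reasoning

      T : Matrix 𝔽 b
      T = toeplitz 𝔽 b a (toℕ j)

      affine-tabulate : ∀ v r → lookup (blockMap j w (tabulate v)) r ≡ K r ⊞ (T · v) r
      affine-tabulate v r = trans (affine (tabulate v) r)
        (cong (K r ⊞_) (·-cong {M = T} (λ _ _ → refl) (lookup∘tabulate v) r))

  -- Transfer between lines of the hypercube and block maps along `Ψ`.

  module _ {N b k : ℕ} (Ψ : Fin N ↔ Vec Carrier b) (F : Vec Carrier (k * b) → Vec Carrier b) where

    open Inverse Ψ using (to; from; strictlyInverseˡ; strictlyInverseʳ)

    private
      block : Fin k → Vec (Vec Carrier b) k → Vec Carrier b → Vec Carrier b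
      block j w u = F (concat (w [ j ]≔ u))

    to-injective : Injective _≡_ _≡_ to
    to-injective eq = trans (sym (strictlyInverseʳ _)) (trans (cong from eq) (strictlyInverseʳ _))

    from-injective : Injective _≡_ _≡_ from
    from-injective eq = trans (sym (strictlyInverseˡ _)) (trans (cong to eq) (strictlyInverseˡ _))

    hypercube-≔ : ∀ j v t → hypercube {k = k} Ψ F (v [ j ]≔ t) ≡ from (block j (map to v) (to t))
    hypercube-≔ j v t = cong (from ∘ F ∘ concat) (map-[]≔ to v j)

    -- Each line is a self-map of the finite set `Fin N`, so surjectivity comes for free.
    injective⇒latin : (∀ j w → Injective _≡_ _≡_ (block j w)) → IsLatinHypercube (hypercube {k = k} Ψ F)
    injective⇒latin inj j v = line-injective , injective⇒surjective line-injective
      where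
      line-injective : Injective _≡_ _≡_ (λ t → hypercube {k = k} Ψ F (v [ j ]≔ t))
      line-injective {t} {t′} eq = to-injective (inj j (map to v) (from-injective
        (trans (sym (hypercube-≔ j v t)) (trans eq (hypercube-≔ j v t′)))))

    latin⇒bijective : IsLatinHypercube (hypercube {k = k} Ψ F) →
      ∀ j v → Bijective _≡_ _≡_ (block j (map to v))
    latin⇒bijective latin j v = injective , surjective
      where
      hypercube-from : ∀ u → hypercube {k = k} Ψ F (v [ j ]≔ from u) ≡ from (block j (map to v) u)
      hypercube-from u = trans (hypercube-≔ j v (from u)) (cong (from ∘ block j (map to v)) (strictlyInverseˡ u))

      injective : Injective _≡_ _≡_ (block j (map to v))
      injective {u} {u′} eq = from-injective (proj₁ (latin j v)
        (trans (hypercube-from u) (trans (cong from eq) (sym (hypercube-from u′)))))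

      surjective : Surjective _≡_ _≡_ (block j (map to v))
      surjective y with proj₂ (latin j v) (from y)
      ... | t , Ht≡ = to t , λ { refl → from-injective (trans (sym (hypercube-≔ j v t)) (Ht≡ refl)) }

theorem2 : ∀ {c ℓ : Level} {q : ℕ} → IsPrimePower q → (𝔽 : FiniteField c q) →
    let open FiniteField 𝔽 using (Carrier) in
    (b k : ℕ) → 1 ≤ b → (3≤k : 3 ≤ k) →
    (_≼_ : Rel (Vec Carrier b) ℓ) → IsTotalOrder _≡_ _≼_ →
    (Ψ : Fin (q ^ b) ↔ Vec Carrier b) → Monotonic₁ _≤ᶠ_ _≼_ (Inverse.to Ψ) →
    (a : ℕ → Carrier) →
    IsLatinHypercube (hypercube {k = k} Ψ (linearCA 𝔽 b k (≤-trans (s≤s z≤n) 3≤k) a))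
    ⇔ (∀ (i : ℕ) → 1 ≤ i → i ≤ k ∸ 2 → IsInvertible 𝔽 (toeplitz 𝔽 b a i))
-- The dimension is now `3 + k`, so the bound `k ∸ 2` of the statement computes to `suc k` and the
-- last block has index `2 + k`.
theorem2 _ 𝔽 b (suc (suc (suc k))) 1≤b (s≤s (s≤s (s≤s z≤n))) _ _ Ψ _ a = mk⇔ latin⇒invertible invertible⇒latin
  where
  F = linearCA 𝔽 b (3 + k) (s≤s z≤n) a

  latin⇒invertible : IsLatinHypercube (hypercube {k = 3 + k} Ψ F) →
    ∀ i → 1 ≤ i → i ≤ suc k → IsInvertible 𝔽 (toeplitz 𝔽 b a i)
  latin⇒invertible latin i 1≤i i≤1+k = subst (λ i → IsInvertible 𝔽 (toeplitz 𝔽 b a i)) toℕ-j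
    (blockMap-invertible 𝔽 b (2 + k) 1≤b (s≤s z≤n) a j
      (subst (1 ≤_) (sym toℕ-j) 1≤i) (subst (_< 2 + k) (sym toℕ-j) (s≤s i≤1+k)) (map (Inverse.to Ψ) v)
      (latin⇒bijective 𝔽 Ψ F latin j v))
    where
    open FiniteField 𝔽 using (0#)

    -- One line in direction `j` suffices, as the matrix is the same for all of them; the zero block
    -- supplies an index to build it from.
    v : Vec (Fin _) (3 + k)
    v = replicate (3 + k) (Inverse.from Ψ (replicate b 0#))

    i<3+k : i < 3 + k
    i<3+k = s≤s (ℕ.m≤n⇒m≤1+n i≤1+k)

    j = fromℕ< i<3+k

    toℕ-j : toℕ j ≡ i
    toℕ-j = toℕ-fromℕ< i<3+k

  invertible⇒latin : (∀ i → 1 ≤ i → i ≤ suc k → IsInvertible 𝔽 (toeplitz 𝔽 b a i)) →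
    IsLatinHypercube (hypercube {k = 3 + k} Ψ F)
  invertible⇒latin inv = injective⇒latin 𝔽 Ψ F block-injective
    where
    block-injective : ∀ j w → Injective _≡_ _≡_ (blockMap 𝔽 b (2 + k) 1≤b (s≤s z≤n) a j w)
    block-injective zero      = blockMap-first-injective 𝔽 b (2 + k) 1≤b (s≤s z≤n) a (s≤s z≤n)
    -- Blocks are counted from 0, so the interior ones are those with `1 ≤ toℕ j < 2 + k`, and
    -- `toℕ j` is exactly the index of the Toeplitz matrix.
    block-injective j@(suc _) with ℕ.m≤n⇒m<n∨m≡n (s≤s⁻¹ (toℕ<n j))
    ... | inj₁ j<2+k = blockMap-injective 𝔽 b (2 + k) 1≤b (s≤s z≤n) a j (s≤s z≤n) j<2+k
                         (inv (toℕ j) (s≤s z≤n) (s≤s⁻¹ j<2+k))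
    ... | inj₂ j≡2+k = blockMap-last-injective 𝔽 b (2 + k) 1≤b (s≤s z≤n) a (s≤s z≤n) j≡2+k
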